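{- There exists an integer $n_0$ such that for every graph $G$ on $n \geq n_0$ vertices with minimum degree $\delta(G) \geq \frac{2n-5}{3}$, and every colouring of the edges of $G$ with two colours, the vertex set of $G$ can be partitioned into two monochromatic connected subgraphs.
   Context: A $2$-coloured graph is a graph whose edges are each assigned one of two colours (red and blue). A monochromatic connected subgraph is a subgraph all of whose edges have the same colour and which is connected (a single vertex counts). "The vertex set can be partitioned into two monochromatic connected subgraphs" means that $V(G)$ is the disjoint union of the vertex sets of two vertex-disjoint monochromatic connected subgraphs; the two subgraphs may have the same colour or different colours. -}

module Defs where

open import Data.Nat using (ℕ; _+_; _*_; _≤_)
open import Data.Fin using (Fin)
open import Data.Bool using (Bool; true; false; not)
open import Data.List using (List; filter; length)
open import Data.Product using (Σ; _×_; ∃; ∃-syntax)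
open import Relation.Binary.PropositionalEquality using (_≡_; _≢_)
open import Relation.Nullary using (¬_)
open import Data.Bool.Properties using () renaming (_≟_ to _≟B_)
open import Data.List using (allFin)

record Graph (n : ℕ) : Set where
  field
    adj       : Fin n → Fin n → Bool
    symmetric : ∀ u v → adj u v ≡ adj v u
    irrefl    : ∀ v → adj v v ≡ false
open Graph public

degree : ∀ {n} → Graph n → Fin n → ℕ
degree G v = length (filter (λ u → adj G v u ≟B true) (allFin _))

-- minimum degree δ(G) ≥ (2n-5)/3, written without division: 3·deg(v) + 5 ≥ 2n
MinDegreeCond : ∀ {n} → Graph n → Set
MinDegreeCond {n} G = ∀ v → 2 * n ≤ 3 * degree G v + 5

-- A 2-colouring of the edges: colour of edge uv (Bool = red/blue),
-- symmetric; its values on non-edges are irrelevant.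
Colouring : ℕ → Set
Colouring n = Fin n → Fin n → Bool

SymColouring : ∀ {n} → Colouring n → Set
SymColouring χ = ∀ u v → χ u v ≡ χ v u

Subset : ℕ → Set
Subset n = Fin n → Bool

data MonoWalk {n} (G : Graph n) (χ : Colouring n) (c : Bool) (S : Subset n)
       : Fin n → Fin n → Set where
  here : ∀ {u} → S u ≡ true → MonoWalk G χ c S u u
  step : ∀ {u w v} → S u ≡ true → adj G u w ≡ true → χ u w ≡ c →
         MonoWalk G χ c S w v → MonoWalk G χ c S u v

MonoConnected : ∀ {n} → Graph n → Colouring n → Bool → Subset n → Set
MonoConnected G χ c S =
  (∃[ v ] S v ≡ true) × (∀ u v → S u ≡ true → S v ≡ true → MonoWalk G χ c S u v)

TwoMonoPartition : ∀ {n} → Graph n → Colouring n → Set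
TwoMonoPartition G χ =
  ∃[ S ] ∃[ c₁ ] ∃[ c₂ ]
    (MonoConnected G χ c₁ S × MonoConnected G χ c₂ (λ v → not (S v)))

{-# OPTIONS --safe #-}
module Submission where

-- Let X, Y, Z be sets with no common vertices and no edges between them, and let x, y, z be
-- members. Counting the vertices that miss at least two of x, y, z against the degree condition
-- shows that x, y, z have a common neighbour outside any F with |F| + 2 < |X| + |Y| + |Z|.
--
-- For singletons this gives that three vertices cannot lie in pairwise distinct red and pairwise
-- distinct blue components, so by König two monochromatic components cover the graph. The case to
-- treat is a red component R and a blue component B. Put X = V ∖ B and Y = V ∖ R: edges leaving X
-- are red, edges leaving Y are blue, and there are none from X to Y. Unless X is blue connected,
-- joining non-adjacent vertices of X by common neighbours makes X red connected with fewer than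
-- |X| further vertices; the same then works for Y, disjointly, with fewer than |Y|. The set I of
-- vertices without neighbours in X ∪ Y is absorbed one vertex z at a time: z and members of X and Y
-- have an unused common neighbour w, and both z and w join the side given by the colour of zw. At
-- most |I| further vertices are used up, so the bound for F = used vertices never fails. Every
-- other vertex has a neighbour in X or in Y and joins that side.

open import Defs
open import Data.Nat using (ℕ; _≤_)
open import Data.Product using (∃-syntax)

open import Data.Bool using (Bool; true; false; not; _∧_; _∨_; if_then_else_)
open import Data.Bool.Properties using (¬-not; not-¬; not-involutive) renaming (_≟_ to _≟B_)
open import Data.Empty using (⊥; ⊥-elim)
open import Data.Fin using (Fin; zero; suc; _≟_)
open import Data.Fin.Properties using (any?)
open import Data.List using (length; filter; tabulate)
open import Data.Nat using (zero; suc; _+_; _*_; _∸_; _<_; z≤n; s≤s)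
open import Data.Nat.Properties
  using (+-0-commutativeMonoid; +-assoc; +-comm; +-suc; +-mono-≤; +-monoˡ-≤; +-monoʳ-≤; +-cancelˡ-≤;
         *-comm; *-zeroʳ; *-cancelˡ-≤; m≤m+n; m≤n+m; m+[n∸m]≡n;
         ≤-refl; ≤-reflexive; ≤-trans; ≤-pred; <⇒≱; <-≤-trans; module ≤-Reasoning)
open import Algebra.Properties.CommutativeMonoid.Sum +-0-commutativeMonoid using (sum) renaming (∑-distrib-+ to sum-+)
open import Data.Nat.Tactic.RingSolver using (solve-∀)
open import Data.Product using (∃; _×_; _,_; proj₁; proj₂)
open import Data.Sum using (_⊎_; inj₁; inj₂; [_,_]′; swap)
open import Function using (_∘_; id)
open import Relation.Binary.PropositionalEquality using (_≡_; _≢_; refl; sym; trans; cong; cong₂; subst)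
open import Relation.Nullary using (¬_; Dec; yes; no; does)
open import Relation.Nullary.Decidable using (_×-dec_; ¬?; dec-true)

private
  variable
    n : ℕ

-- Boolean reasoning and iteration along a measure

true≢false : {b : Bool} → b ≡ true → b ≡ false → ⊥
true≢false refl ()

∧-true : ∀ {a b} → a ∧ b ≡ true → a ≡ true × b ≡ true
∧-true {true} {true} refl = refl , refl

∨-true : ∀ {a b} → a ∨ b ≡ true → a ≡ true ⊎ b ≡ true
∨-true {true}  _ = inj₁ refl
∨-true {false} e = inj₂ e

∨-false : ∀ {a b} → a ∨ b ≡ false → a ≡ false × b ≡ false
∨-false {false} {false} refl = refl , refl

not-true : ∀ {a} → not a ≡ true → a ≡ false
not-true {false} refl = refl

does-true : {A : Set} (a? : Dec A) → does a? ≡ true → A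
does-true (yes a) _ = a

-- The loop behind every greedy construction below: a round either delivers the result or returns a
-- state of smaller measure. Recursion is on an upper bound `k` of the measure, which makes it
-- structural.
descend : {A B : Set} (μ : A → ℕ) → (∀ s → B ⊎ ∃[ s′ ] μ s′ < μ s) → A → B
descend {A} {B} μ next s = go (μ s) s ≤-refl
  where
  go : ∀ k s → μ s ≤ k → B
  go k s μ≤k with next s
  go k s μ≤k       | inj₁ b = b
  go zero s μ≤k    | inj₂ (_ , lt) = ⊥-elim (<⇒≱ (<-≤-trans lt μ≤k) z≤n)
  go (suc k) s μ≤k | inj₂ (s′ , lt) = go k s′ (≤-pred (<-≤-trans lt μ≤k))

-- Counting

sum-mono : {f g : Fin n → ℕ} → (∀ t → f t ≤ g t) → sum f ≤ sum g
sum-mono {zero}  _ = z≤n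
sum-mono {suc n} h = +-mono-≤ (h zero) (sum-mono (h ∘ suc))

sum-const : ∀ k → sum {n} (λ _ → k) ≡ n * k
sum-const {zero}  k = refl
sum-const {suc n} k = cong (k +_) (sum-const {n} k)

⟦_⟧ : Bool → ℕ
⟦ b ⟧ = if b then 1 else 0

⟦⟧≤1 : ∀ b → ⟦ b ⟧ ≤ 1
⟦⟧≤1 true  = ≤-refl
⟦⟧≤1 false = z≤n

𝟙 : Subset n → Fin n → ℕ
𝟙 S t = ⟦ S t ⟧

infix 8 #_

#_ : Subset n → ℕ
# S = sum (𝟙 S)

∅ : Subset n
∅ t = false

⁅_⁆ : Fin n → Subset n
⁅ u ⁆ t = does (u ≟ t)

∁ : Subset n → Subset n
∁ S t = not (S t)

infixl 6 _∖_ _∪_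

_∖_ _∪_ : Subset n → Subset n → Subset n
(S ∖ T) t = S t ∧ not (T t)
(S ∪ T) t = S t ∨ T t

insert : Fin n → Subset n → Subset n
insert w S = S ∪ ⁅ w ⁆

#-∅ : # ∅ {n} ≡ 0
#-∅ {n} = trans (sum-const {n} 0) (*-zeroʳ n)

#-⁅⁆ : (u : Fin n) → # ⁅ u ⁆ ≡ 1
#-⁅⁆ {suc n} zero    = cong suc (#-∅ {n})
#-⁅⁆ {suc n} (suc u) = #-⁅⁆ u

∈-⁅⁆ : {u t : Fin n} → ⁅ u ⁆ t ≡ true → u ≡ t
∈-⁅⁆ {u = u} {t} = does-true (u ≟ t)

∈-∖ : {S T : Subset n} {t : Fin n} → S t ≡ true → T t ≡ false → (S ∖ T) t ≡ true
∈-∖ p q rewrite p | q = refl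

∈-∖⁻ : {S T : Subset n} {t : Fin n} → (S ∖ T) t ≡ true → S t ≡ true × T t ≡ false
∈-∖⁻ e with p , q ← ∧-true e = p , not-true q

∉-∖ : {S T : Subset n} {t : Fin n} → (S ∖ T) t ≡ false → T t ≡ false → S t ≡ false
∉-∖ {S = S} {T} {t} e q with S t
... | false = refl
... | true rewrite q with () ← e

∪-introˡ : {S T : Subset n} {t : Fin n} → S t ≡ true → (S ∪ T) t ≡ true
∪-introˡ p rewrite p = refl

∪-introʳ : {S T : Subset n} {t : Fin n} → T t ≡ true → (S ∪ T) t ≡ true
∪-introʳ {S = S} {t = t} q with S t
... | true  = refl
... | false = q

∉-∪ : {S T : Subset n} {t : Fin n} → S t ≡ false → T t ≡ false → (S ∪ T) t ≡ false
∉-∪ p q rewrite p = q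

∪-mono : {S T S′ T′ : Subset n} → (∀ t → S t ≡ true → S′ t ≡ true) → (∀ t → T t ≡ true → T′ t ≡ true) →
         ∀ t → (S ∪ T) t ≡ true → (S′ ∪ T′) t ≡ true
∪-mono {S′ = S′} {T′} f g t e with ∨-true e
... | inj₁ p = ∪-introˡ {S = S′} {T′} (f t p)
... | inj₂ q = ∪-introʳ {S = S′} {T′} (g t q)

∈-insertˡ : {w : Fin n} {S : Subset n} {t : Fin n} → S t ≡ true → insert w S t ≡ true
∈-insertˡ {w = w} {S} = ∪-introˡ {S = S} {⁅ w ⁆}

∈-insert : (w : Fin n) (S : Subset n) → insert w S w ≡ true
∈-insert w S = ∪-introʳ {S = S} {⁅ w ⁆} (dec-true (w ≟ w) refl)

∈-insert⁻ : {w : Fin n} {S : Subset n} {t : Fin n} → insert w S t ≡ true → S t ≡ true ⊎ w ≡ t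
∈-insert⁻ {S = S} e with ∨-true e
... | inj₁ p = inj₁ p
... | inj₂ q = inj₂ (∈-⁅⁆ q)

∉-insert⁻ : {w : Fin n} {S : Subset n} {t : Fin n} → insert w S t ≡ false → S t ≡ false × w ≢ t
∉-insert⁻ {w = w} {S} e = proj₁ (∨-false e) , λ { refl → true≢false (∈-insert w S) e }

#-∪ : {S T U : Subset n} → (∀ t → S t ≡ true → T t ≡ true ⊎ U t ≡ true) → # S ≤ # T + # U
#-∪ {S = S} {T} {U} h = ≤-trans (sum-mono pointwise) (≤-reflexive (sum-+ (𝟙 T) (𝟙 U)))
  where
  pointwise : ∀ t → ⟦ S t ⟧ ≤ ⟦ T t ⟧ + ⟦ U t ⟧
  pointwise t with S t in eq
  ... | false = z≤n
  ... | true with h t eq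
  ...   | inj₁ p rewrite p = s≤s z≤n
  ...   | inj₂ q rewrite q = m≤n+m 1 ⟦ T t ⟧

#-mono : {S T : Subset n} → (∀ t → S t ≡ true → T t ≡ true) → # S ≤ # T
#-mono {S = S} {T} h = sum-mono pointwise
  where
  pointwise : ∀ t → ⟦ S t ⟧ ≤ ⟦ T t ⟧
  pointwise t with S t in eq
  ... | false = z≤n
  ... | true rewrite h t eq = ≤-refl

#-insert : {S T : Subset n} {w : Fin n} → (∀ t → S t ≡ true → T t ≡ true ⊎ w ≡ t) → # S ≤ suc (# T)
#-insert {S = S} {T} {w} h = begin
  # S               ≤⟨ #-∪ (λ t e → h′ t (h t e)) ⟩
  # T + # ⁅ w ⁆   ≡⟨ cong (# T +_) (#-⁅⁆ w) ⟩
  # T + 1           ≡⟨ +-comm (# T) 1 ⟩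
  suc (# T)           ∎
  where
  open ≤-Reasoning
  h′ : ∀ t → T t ≡ true ⊎ w ≡ t → T t ≡ true ⊎ ⁅ w ⁆ t ≡ true
  h′ t (inj₁ p)    = inj₁ p
  h′ t (inj₂ refl) = inj₂ (dec-true (w ≟ w) refl)

-- All strict decreases of the measures passed to `descend` come from here. With `S` empty it says
-- that a set with a member has positive size.
#-remove : {S T : Subset n} {w : Fin n} → T w ≡ true → (∀ t → S t ≡ true → T t ≡ true × w ≢ t) → # S < # T
#-remove {S = S} {T} {w} Tw h = begin
  suc (# S)           ≡⟨ cong (_+ # S) (#-⁅⁆ w) ⟨
  # ⁅ w ⁆ + # S   ≡⟨ sum-+ (𝟙 ⁅ w ⁆) (𝟙 S) ⟨
  sum (λ t → ⟦ ⁅ w ⁆ t ⟧ + ⟦ S t ⟧) ≤⟨ sum-mono pointwise ⟩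
  # T               ∎
  where
  open ≤-Reasoning
  pointwise : ∀ t → ⟦ ⁅ w ⁆ t ⟧ + ⟦ S t ⟧ ≤ ⟦ T t ⟧
  pointwise t with w ≟ t | S t in eq
  ... | no _     | false = z≤n
  ... | no _     | true rewrite proj₁ (h t eq) = ≤-refl
  ... | yes refl | false rewrite Tw = ≤-refl
  ... | yes refl | true = ⊥-elim (proj₂ (h t eq) refl)

-- Degrees and common neighbours

degree-sum : (G : Graph n) (v : Fin n) → degree G v ≡ # adj G v
degree-sum {n} G v = go id
  where
  -- `allFin` is `tabulate id`; the induction needs an arbitrary function in place of `id`.
  go : ∀ {m} (f : Fin m → Fin n) →
       length (filter (λ u → adj G v u ≟B true) (tabulate f)) ≡ sum (λ i → ⟦ adj G v (f i) ⟧)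
  go {zero}  f = refl
  go {suc m} f with adj G v (f zero)
  ... | true  = cong suc (go (f ∘ suc))
  ... | false = go (f ∘ suc)

adj# : Graph n → Fin n → Fin n → Fin n → Fin n → ℕ
adj# G u v w t = ⟦ adj G u t ⟧ + ⟦ adj G v t ⟧ + ⟦ adj G w t ⟧

module _ (G : Graph n) (δ≥ : MinDegreeCond G) where

  -- Three degree conditions add up to 6n on the left and three times the degree sum plus 15 on the
  -- right, so dividing by 3 loses nothing.
  triple-degree : ∀ u v w → 2 * n ≤ (# adj G u + # adj G v + # adj G w) + 5
  triple-degree u v w = *-cancelˡ-≤ 3 (begin
    3 * (2 * n)                       ≡⟨ thrice (2 * n) ⟩
    2 * n + 2 * n + 2 * n             ≤⟨ +-mono-≤ (+-mono-≤ (δ≥′ u) (δ≥′ v)) (δ≥′ w) ⟩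
    (3 * # adj G u + 5) + (3 * # adj G v + 5) + (3 * # adj G w + 5)
                                      ≡⟨ regroup (# adj G u) (# adj G v) (# adj G w) ⟩
    3 * ((# adj G u + # adj G v + # adj G w) + 5) ∎)
    where
    open ≤-Reasoning
    δ≥′ : ∀ v → 2 * n ≤ 3 * # adj G v + 5
    δ≥′ v = subst (λ d → 2 * n ≤ 3 * d + 5) (degree-sum G v) (δ≥ v)
    thrice : ∀ a → 3 * a ≡ a + a + a
    thrice = solve-∀
    regroup : ∀ a b c → (3 * a + 5) + (3 * b + 5) + (3 * c + 5) ≡ 3 * ((a + b + c) + 5)
    regroup = solve-∀

  -- K measures how far each vertex is from being adjacent to two of u, v, w; a large total
  -- deficit has to be compensated by vertices adjacent to all three.
  common-neighbour : ∀ u v w (K : Fin n → ℕ) (F : Subset n) →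
    (∀ t → K t ≤ 2 ∸ adj# G u v w t) → 5 + # F < sum K →
    ∃[ t ] (F t ≡ false × adj G u t ≡ true × adj G v t ≡ true × adj G w t ≡ true)
  common-neighbour u v w K F K≤ big
    with any? (λ t → (F t ≟B false) ×-dec (adj G u t ≟B true) ×-dec (adj G v t ≟B true) ×-dec (adj G w t ≟B true))
  ... | yes found = found
  ... | no none   = ⊥-elim (<⇒≱ big (+-cancelˡ-≤ D _ _ (begin
    D + sum K                              ≡⟨ cong (_+ sum K) split ⟨
    sum (adj# G u v w) + sum K               ≡⟨ sum-+ (adj# G u v w) K ⟨
    sum (λ t → adj# G u v w t + K t)         ≤⟨ sum-mono pointwise ⟩
    sum (λ t → 2 + ⟦ F t ⟧)                ≡⟨ sum-+ (λ _ → 2) (𝟙 F) ⟩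
    sum {n} (λ _ → 2) + # F              ≡⟨ cong (_+ # F) (trans (sum-const {n} 2) (*-comm n 2)) ⟩
    2 * n + # F                          ≤⟨ +-monoˡ-≤ (# F) (triple-degree u v w) ⟩
    D + 5 + # F                          ≡⟨ +-assoc D 5 (# F) ⟩
    D + (5 + # F)                        ∎)))
    where
    open ≤-Reasoning
    split : sum (adj# G u v w) ≡ # adj G u + # adj G v + # adj G w
    split = trans (sum-+ (λ t → ⟦ adj G u t ⟧ + ⟦ adj G v t ⟧) (𝟙 (adj G w)))
                  (cong (_+ # adj G w) (sum-+ (𝟙 (adj G u)) (𝟙 (adj G v))))
    D = # adj G u + # adj G v + # adj G w
    deficit : ∀ {a k} → a ≤ 2 → k ≤ 2 ∸ a → a + k ≤ 2
    deficit {a} a≤2 k≤ = ≤-trans (+-monoʳ-≤ a k≤) (≤-reflexive (m+[n∸m]≡n a≤2))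
    pointwise : ∀ t → adj# G u v w t + K t ≤ 2 + ⟦ F t ⟧
    pointwise t with K≤ t
    ... | k≤ with adj G u t in p | adj G v t in q | adj G w t in r
    ... | false | b | c = ≤-trans (deficit (+-mono-≤ (⟦⟧≤1 b) (⟦⟧≤1 c)) k≤) (m≤m+n 2 _)
    ... | true | false | c = ≤-trans (deficit (s≤s (⟦⟧≤1 c)) k≤) (m≤m+n 2 _)
    ... | true | true | false = ≤-trans (deficit ≤-refl k≤) (m≤m+n 2 _)
    ... | true | true | true with F t in f
    -- Here `2 ∸ 3` truncates to 0, so `K t` vanishes, and the third adjacency is paid for by the
    -- membership of `t` in `F`.
    ...   | true  = s≤s (s≤s (s≤s k≤))
    ...   | false = ⊥-elim (none (t , f , p , q , r))

-- Monochromatic connectivity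

module _ (G : Graph n) (χ : Colouring n) (χ-sym : SymColouring χ) where

  Edge : Bool → Fin n → Fin n → Set
  Edge c u v = adj G u v ≡ true × χ u v ≡ c

  Walk : Bool → Subset n → Fin n → Fin n → Set
  Walk = MonoWalk G χ

  Connected : Bool → Subset n → Set
  Connected = MonoConnected G χ

  Closed : Bool → Subset n → Set
  Closed c C = ∀ u v → C u ≡ true → Edge c u v → C v ≡ true

  edge-sym : ∀ {c u v} → Edge c u v → Edge c v u
  edge-sym {u = u} {v} (a , e) = trans (symmetric G v u) a , trans (χ-sym v u) e

  edge? : ∀ c u v → Dec (Edge c u v)
  edge? c u v = (adj G u v ≟B true) ×-dec (χ u v ≟B c)

  walk-⊆ : ∀ {c S T u v} → (∀ t → S t ≡ true → T t ≡ true) → Walk c S u v → Walk c T u v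
  walk-⊆ h (here s)         = here (h _ s)
  walk-⊆ h (step s a e w)   = step (h _ s) a e (walk-⊆ h w)

  walk-snoc : ∀ {c S u v w} → Walk c S u v → S w ≡ true → Edge c v w → Walk c S u w
  walk-snoc (here s) Sw (a , e)         = step s a e (here Sw)
  walk-snoc (step s a e ws) Sw f        = step s a e (walk-snoc ws Sw f)

  edge-walk : ∀ {c S u v} → S u ≡ true → S v ≡ true → Edge c u v → Walk c S u v
  edge-walk Su Sv (a , e) = step Su a e (here Sv)

  walk-closed : ∀ {c S C u v} → Closed c C → Walk c S u v → C u ≡ true → C v ≡ true
  walk-closed cl (here _) Cu       = Cu
  walk-closed cl (step _ a e w) Cu = walk-closed cl w (cl _ _ Cu (a , e))

  connected-cong : ∀ {c S T} → (∀ t → S t ≡ true → T t ≡ true) → (∀ t → T t ≡ true → S t ≡ true) →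
                   Connected c S → Connected c T
  connected-cong S⊆T T⊆S ((v , Sv) , ws) =
    (v , S⊆T v Sv) , λ u w Tu Tw → walk-⊆ S⊆T (ws u w (T⊆S u Tu) (T⊆S w Tw))

  connected-⁅⁆ : ∀ c u → Connected c ⁅ u ⁆
  connected-⁅⁆ c u = (u , dec-true (u ≟ u) refl) , walks
    where
    walks : ∀ v w → ⁅ u ⁆ v ≡ true → ⁅ u ⁆ w ≡ true → Walk c ⁅ u ⁆ v w
    walks v w p q with refl ← ∈-⁅⁆ {u = u} p | refl ← ∈-⁅⁆ {u = u} q = here p

  connected-insert : ∀ {c C u v} → Connected c C → C u ≡ true → Edge c u v → Connected c (insert v C)
  connected-insert {c} {C} {u} {v} ((r , Cr) , ws) Cu e =
    (r , up r Cr) , walks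
    where
    up : ∀ t → C t ≡ true → insert v C t ≡ true
    up t = ∈-insertˡ {w = v} {S = C}
    v∈ : insert v C v ≡ true
    v∈ = ∈-insert v C
    walks : ∀ s t → insert v C s ≡ true → insert v C t ≡ true → Walk c (insert v C) s t
    walks s t p q with ∈-insert⁻ {w = v} {S = C} p | ∈-insert⁻ {w = v} {S = C} q
    ... | inj₁ Cs   | inj₁ Ct   = walk-⊆ up (ws s t Cs Ct)
    ... | inj₁ Cs   | inj₂ refl = walk-snoc (walk-⊆ up (ws s u Cs Cu)) v∈ e
    ... | inj₂ refl | inj₁ Ct   = step v∈ (proj₁ (edge-sym e)) (proj₂ (edge-sym e)) (walk-⊆ up (ws u t Cu Ct))
    ... | inj₂ refl | inj₂ refl = here v∈

  partition : ∀ {c d} P Q → Connected c P → Connected d Q →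
              (∀ t → P t ≡ true → Q t ≡ true → ⊥) → (∀ t → P t ≡ true ⊎ Q t ≡ true) → TwoMonoPartition G χ
  partition {c} {d} P Q connP connQ disjoint cover =
    P , c , d , connP , connected-cong Q⊆∁P ∁P⊆Q connQ
    where
    Q⊆∁P : ∀ t → Q t ≡ true → not (P t) ≡ true
    Q⊆∁P t Qt with P t in eq
    ... | true  = ⊥-elim (disjoint t eq Qt)
    ... | false = refl
    ∁P⊆Q : ∀ t → not (P t) ≡ true → Q t ≡ true
    ∁P⊆Q t ¬Pt with cover t
    ... | inj₁ Pt = ⊥-elim (true≢false Pt (not-true ¬Pt))
    ... | inj₂ Qt = Qt

  -- Monochromatic components

  crossing? : ∀ c (C : Subset n) → Closed c C ⊎ ∃[ u ] ∃[ v ] (C u ≡ true × C v ≡ false × Edge c u v)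
  crossing? c C with any? (λ u → any? (λ v → (C u ≟B true) ×-dec (C v ≟B false) ×-dec edge? c u v))
  ... | yes found = inj₂ found
  ... | no none   = inj₁ (λ u v Cu e → closed u v Cu e)
    where
    closed : Closed c C
    closed u v Cu e with C v in eq
    ... | true  = refl
    ... | false = ⊥-elim (none (u , v , Cu , eq , e))

  #-∁-insert : ∀ {C : Subset n} {v} → C v ≡ false → # ∁ (insert v C) < # ∁ C
  #-∁-insert {C} {v} Cv = #-remove {w = v} (cong not Cv)
    (λ t p → let q , r = ∉-insert⁻ {w = v} {S = C} (not-true p) in cong not q , r)

  -- Endpoints of crossing edges are added to the set of `u` alone until none is left. A connected
  -- set that is also closed is a full component.
  component-∃ : ∀ c u → ∃[ C ] (Connected c C × C u ≡ true × Closed c C)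
  component-∃ c u = descend {A = ∃[ C ] (Connected c C × C u ≡ true)} (λ (C , _) → # ∁ C) grow
    (⁅ u ⁆ , connected-⁅⁆ c u , dec-true (u ≟ u) refl)
    where
    grow : ((C , _) : ∃[ C ] (Connected c C × C u ≡ true)) →
           (∃[ C ] (Connected c C × C u ≡ true × Closed c C)) ⊎ _
    grow (C , conn , Cu) with crossing? c C
    ... | inj₁ closed = inj₁ (C , conn , Cu , closed)
    ... | inj₂ (p , q , Cp , Cq , e) =
      inj₂ ((insert q C , connected-insert conn Cp e , ∈-insertˡ {w = q} {S = C} Cu) , #-∁-insert {C} Cq)

  component : Bool → Fin n → Subset n
  component c u = proj₁ (component-∃ c u)

  component-connected : ∀ c u → Connected c (component c u)
  component-connected c u = proj₁ (proj₂ (component-∃ c u))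

  component-refl : ∀ c u → component c u u ≡ true
  component-refl c u = proj₁ (proj₂ (proj₂ (component-∃ c u)))

  component-closed : ∀ c u → Closed c (component c u)
  component-closed c u = proj₂ (proj₂ (proj₂ (component-∃ c u)))

  -- `component c u` and `component c v` come from separate searches. They are compared by running a
  -- walk inside one of them through the other, which no walk of colour `c` can leave.
  component-trans : ∀ {c u v w} → component c u v ≡ true → component c v w ≡ true → component c u w ≡ true
  component-trans {c} {u} {v} {w} uv vw =
    walk-closed (component-closed c u) (proj₂ (component-connected c v) v w (component-refl c v) vw) uv

  component-sym : ∀ {c u v} → component c u v ≡ true → component c v u ≡ true
  component-sym {c} {u} {v} uv =
    walk-closed (component-closed c v) (proj₂ (component-connected c u) v u uv (component-refl c u)) (component-refl c v)

  -- A vertex added last while growing a connected set is not a cut vertex.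
  whole-connected : ∀ {c u v C} → u ≢ v → Connected c C → (∀ t → C t ≡ true) → TwoMonoPartition G χ
  whole-connected {c} {u} {v} {C} u≢v (_ , walks) all =
    descend {A = State} (λ (D , _) → # ∁ D) grow (⁅ u ⁆ , v , connected-⁅⁆ c u , v∉)
    where
    -- `w` is a vertex held back from `D`; once it is the only one outside, `D` and `w` form the
    -- partition.
    State : Set
    State = ∃[ D ] ∃[ w ] (Connected c D × D w ≡ false)
    v∉ : ⁅ u ⁆ v ≡ false
    v∉ with u ≟ v
    ... | yes e = ⊥-elim (u≢v e)
    ... | no _  = refl
    ∉-insert : ∀ {w q D} → D w ≡ false → q ≢ w → insert q D w ≡ false
    ∉-insert {w} {q} Dw q≢w rewrite Dw with q ≟ w
    ... | yes e = ⊥-elim (q≢w e)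
    ... | no _  = refl
    grow : ((D , w , _) : State) → TwoMonoPartition G χ ⊎ ∃[ s ] # ∁ (proj₁ s) < # ∁ D
    grow (D , w , conn@((r , Dr) , _) , Dw) with any? (λ t → (D t ≟B false) ×-dec ¬? (t ≟ w))
    ... | no none = inj₁ (partition D ⁅ w ⁆ conn (connected-⁅⁆ true w) disjoint cover)
      where
      disjoint : ∀ t → D t ≡ true → ⁅ w ⁆ t ≡ true → ⊥
      disjoint t Dt wt with refl ← ∈-⁅⁆ {u = w} wt = true≢false Dt Dw
      cover : ∀ t → D t ≡ true ⊎ ⁅ w ⁆ t ≡ true
      cover t with D t in eq
      ... | true  = inj₁ refl
      ... | false with w ≟ t
      ...   | yes _  = inj₂ refl
      ...   | no w≢t = ⊥-elim (none (t , eq , w≢t ∘ sym))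
    ... | yes (x , Dx , x≢w) with crossing? c D
    ...   | inj₁ closed = ⊥-elim (true≢false (walk-closed closed (walks r w (all r) (all w)) Dr) Dw)
    ...   | inj₂ (p , q , Dp , Dq , e) with q ≟ w
    -- The crossing edge ends in the vertex held back, so that vertex is added and `x` is held back
    -- in its place.
    ...     | yes refl = inj₂ ((insert q D , x , connected-insert conn Dp e , ∉-insert {D = D} Dx (x≢w ∘ sym)) , #-∁-insert {D} Dq)
    ...     | no q≢w   = inj₂ ((insert q D , w , connected-insert conn Dp e , ∉-insert {D = D} Dw q≢w) , #-∁-insert {D} Dq)

  -- Connecting a set whose outgoing edges have one colour

  -- The predicate `O` limits the additional vertices, which keeps two hulls disjoint. The strict
  -- bound on their number leaves room for further common neighbours.
  Hull : Bool → Subset n → (Fin n → Set) → Subset n → Set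
  Hull c A O C = Connected c C × (∀ t → A t ≡ true → C t ≡ true) ×
                 (∀ t → C t ≡ true → A t ≡ true ⊎ O t) × # (C ∖ A) < # A

  -- C is grown from a₀ within A ∪ O. If it stops before covering A, all pairs between A ∩ C and
  -- A ∖ C are edges of the other colour, and such a complete bipartite graph connects A.
  connect : ∀ {c A a₀} (O : Fin n → Set) → A a₀ ≡ true →
    (∀ a t → A a ≡ true → A t ≡ false → adj G a t ≡ true → χ a t ≡ c) →
    (∀ a b → A a ≡ true → A b ≡ true → a ≢ b → adj G a b ≡ false →
       ∃[ w ] (O w × A w ≡ false × adj G a w ≡ true × adj G b w ≡ true)) →
    Connected (not c) A ⊎ ∃[ C ] Hull c A O C
  connect {c} {A} {a₀} O Aa₀ outward link =
    descend {A = State} (λ (C , _) → # (A ∖ C)) grow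
      (⁅ a₀ ⁆ , connected-⁅⁆ c a₀ , dec-true (a₀ ≟ a₀) refl , only-a₀ , start)
    where
    -- Each new vertex of `A` costs at most one connector outside `A`, so connectors used plus
    -- vertices of `A` still missing stay below the size of `A`.
    Invariant : Subset n → Set
    Invariant C = Connected c C × C a₀ ≡ true × (∀ t → C t ≡ true → A t ≡ true ⊎ O t) × # (C ∖ A) + # (A ∖ C) < # A
    State : Set
    State = ∃[ C ] Invariant C

    only-a₀ : ∀ t → ⁅ a₀ ⁆ t ≡ true → A t ≡ true ⊎ O t
    only-a₀ t e with refl ← ∈-⁅⁆ {u = a₀} e = inj₁ Aa₀

    start : # (⁅ a₀ ⁆ ∖ A) + # (A ∖ ⁅ a₀ ⁆) < # A
    start = ≤-trans (s≤s (+-monoˡ-≤ (# (A ∖ ⁅ a₀ ⁆)) none)) (#-remove {w = a₀} Aa₀ others)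
      where
      none : # (⁅ a₀ ⁆ ∖ A) ≤ 0
      none = ≤-trans (#-mono {T = ∅} outside) (≤-reflexive (#-∅ {n}))
        where
        outside : ∀ t → (⁅ a₀ ⁆ ∖ A) t ≡ true → false ≡ true
        outside t e with p , q ← ∈-∖⁻ {S = ⁅ a₀ ⁆} {A} e with refl ← ∈-⁅⁆ {u = a₀} p = ⊥-elim (true≢false Aa₀ q)
      others : ∀ t → (A ∖ ⁅ a₀ ⁆) t ≡ true → A t ≡ true × a₀ ≢ t
      others t e = let p , q = ∈-∖⁻ {S = A} {⁅ a₀ ⁆} e in p , λ { refl → true≢false (dec-true (a₀ ≟ a₀) refl) q }

    -- This serves both ways of reaching `v`: through a connector `w` satisfying `O`, or along an
    -- edge from `w` already in `C`.
    extend : ∀ {C C′ w v} → Invariant C → Connected c C′ → A v ≡ true → C v ≡ false → C′ v ≡ true →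
             O w ⊎ C w ≡ true →
             (∀ t → C t ≡ true → C′ t ≡ true) → (∀ t → C′ t ≡ true → C t ≡ true ⊎ w ≡ t ⊎ v ≡ t) →
             ∃ λ (s : State) → # (A ∖ proj₁ s) < # (A ∖ C)
    extend {C} {C′} {w} {v} (_ , Ca₀ , C⊆ , bound) conn′ Av Cv C′v Ow C⊆C′ C′⊆ =
      (C′ , conn′ , C⊆C′ a₀ Ca₀ , C′⊆A∪O , bound′) , fewer
      where
      C′⊆A∪O : ∀ t → C′ t ≡ true → A t ≡ true ⊎ O t
      C′⊆A∪O t e with C′⊆ t e
      ... | inj₁ Ct          = C⊆ t Ct
      ... | inj₂ (inj₂ refl) = inj₁ Av
      ... | inj₂ (inj₁ refl) = [ inj₂ , C⊆ w ]′ Ow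
      fewer : # (A ∖ C′) < # (A ∖ C)
      fewer = #-remove {w = v} (∈-∖ {S = A} {C} Av Cv) shrink
        where
        shrink : ∀ t → (A ∖ C′) t ≡ true → (A ∖ C) t ≡ true × v ≢ t
        shrink t e with At , C′t ← ∈-∖⁻ {S = A} {C′} e with C t in eq
        ... | true  = ⊥-elim (true≢false (C⊆C′ t eq) C′t)
        ... | false rewrite At = refl , λ { refl → true≢false C′v C′t }
      one-more : # (C′ ∖ A) ≤ suc (# (C ∖ A))
      one-more = #-insert {w = w} new
        where
        new : ∀ t → (C′ ∖ A) t ≡ true → (C ∖ A) t ≡ true ⊎ w ≡ t
        new t e with C′t , At ← ∈-∖⁻ {S = C′} {A} e with C′⊆ t C′t
        ... | inj₁ Ct          = inj₁ (∈-∖ {S = C} {A} Ct At)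
        ... | inj₂ (inj₁ w≡t)  = inj₂ w≡t
        ... | inj₂ (inj₂ refl) = ⊥-elim (true≢false Av At)
      bound′ : # (C′ ∖ A) + # (A ∖ C′) < # A
      bound′ = ≤-trans (s≤s (begin
        # (C′ ∖ A) + # (A ∖ C′)        ≤⟨ +-monoˡ-≤ (# (A ∖ C′)) one-more ⟩
        suc (# (C ∖ A)) + # (A ∖ C′)   ≡⟨ +-suc (# (C ∖ A)) (# (A ∖ C′)) ⟨
        # (C ∖ A) + suc (# (A ∖ C′))   ≤⟨ +-monoʳ-≤ (# (C ∖ A)) fewer ⟩
        # (C ∖ A) + # (A ∖ C)          ∎)) bound
        where open ≤-Reasoning

    grow : ((C , _) : State) → (Connected (not c) A ⊎ ∃[ C ] Hull c A O C) ⊎ ∃ λ (s : State) → # (A ∖ proj₁ s) < # (A ∖ C)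
    grow (C , inv@(conn , Ca₀ , C⊆ , bound)) with any? (λ t → (A t ≟B true) ×-dec (C t ≟B false))
    ... | no none = inj₁ (inj₂ (C , conn , A⊆C , C⊆ , ≤-trans (s≤s (m≤m+n _ _)) bound))
      where
      A⊆C : ∀ t → A t ≡ true → C t ≡ true
      A⊆C t At with C t in eq
      ... | true  = refl
      ... | false = ⊥-elim (none (t , At , eq))
    ... | yes (b , Ab , Cb)
      with any? (λ u → any? (λ v → (A u ≟B true) ×-dec (C u ≟B true) ×-dec
                                       (A v ≟B true) ×-dec (C v ≟B false) ×-dec ¬? (edge? (not c) u v)))
    ...   | no none = inj₁ (inj₁ ((a₀ , Aa₀) , walks))
      where
      across : ∀ {u v} → A u ≡ true → C u ≡ true → A v ≡ true → C v ≡ false → Edge (not c) u v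
      across {u} {v} Au Cu Av Cv with edge? (not c) u v
      ... | yes e = e
      ... | no ¬e = ⊥-elim (none (u , v , Au , Cu , Av , Cv , ¬e))
      walks : ∀ u v → A u ≡ true → A v ≡ true → Walk (not c) A u v
      walks u v Au Av with C u in Cu | C v in Cv
      ... | true  | false = edge-walk Au Av (across Au Cu Av Cv)
      ... | false | true  = edge-walk Au Av (edge-sym (across Av Cv Au Cu))
      -- Vertices on the same side are joined through the other side: `b` lies outside `C`, `a₀`
      -- inside.
      ... | true  | true  = walk-snoc (edge-walk Au Ab (across Au Cu Ab Cb)) Av (edge-sym (across Av Cv Ab Cb))
      ... | false | false = walk-snoc (edge-walk Au Aa₀ (edge-sym (across Aa₀ Ca₀ Au Cu))) Av (across Aa₀ Ca₀ Av Cv)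
    ...   | yes (u , v , Au , Cu , Av , Cv , ¬e) with adj G u v in uv
    ...     | true = inj₂ (extend {C} {insert v C} {u} {v} inv
                (connected-insert conn Cu (uv , trans (¬-not (λ e → ¬e (refl , e))) (not-involutive c)))
                Av Cv (∈-insert v C) (inj₂ Cu) (λ t → ∈-insertˡ {w = v} {S = C})
                (λ t e → [ inj₁ , inj₂ ∘ inj₂ ]′ (∈-insert⁻ {w = v} {S = C} e)))
    -- The connector lies outside `A`, so its edges to `u` and `v` both leave `A` and have colour
    -- `c`.
    ...     | false with w , Ow , Aw , uw , vw ← link u v Au Av (λ { refl → true≢false Cu Cv }) uv =
              inj₂ (extend {C} {insert v (insert w C)} {w} {v} inv
                (connected-insert
                  (connected-insert conn Cu (uw , outward u w Au Aw uw))
                  (∈-insert w C)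
                  (edge-sym (vw , outward v w Av Aw vw)))
                Av Cv (∈-insert v (insert w C)) (inj₁ Ow)
                (λ t e → ∈-insertˡ {w = v} {S = insert w C} (∈-insertˡ {w = w} {S = C} e))
                (λ t e → [ [ inj₁ , inj₂ ∘ inj₁ ]′ ∘ ∈-insert⁻ {w = w} {S = C} , inj₂ ∘ inj₂ ]′
                           (∈-insert⁻ {w = v} {S = insert w C} e)))

  -- Apart vertices and separated sets

  component-≢ : ∀ {c u v w} → component c u v ≡ true → component c u w ≡ false → component c v w ≡ false
  component-≢ {c} {u} {v} {w} uv uw with component c v w in eq
  ... | false = refl
  ... | true  = ⊥-elim (true≢false (component-trans uv eq) uw)

  component-≢-sym : ∀ {c u v} → component c u v ≡ false → component c v u ≡ false
  component-≢-sym {c} {u} {v} uv with component c v u in eq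
  ... | false = refl
  ... | true  = ⊥-elim (true≢false (component-sym eq) uv)

  -- If a vertex is read as an edge joining its red component to its blue one, apart vertices are
  -- disjoint edges, that is, a matching.
  Apart : Fin n → Fin n → Set
  Apart u v = ∀ c → component c u v ≡ false

  apart : ∀ {u v} → component true u v ≡ false → component false u v ≡ false → Apart u v
  apart t f true  = t
  apart t f false = f

  apart-≢ : ∀ {u v} → Apart u v → u ≢ v
  apart-≢ {u} a refl = true≢false (component-refl true u) (a true)

  apart-nonadjacent : ∀ {u v} → Apart u v → adj G u v ≡ false
  apart-nonadjacent {u} {v} a with adj G u v in eq
  ... | false = refl
  ... | true  = ⊥-elim (true≢false (component-closed (χ u v) u u v (component-refl _ u) (eq , refl)) (a (χ u v)))

  Separated : Subset n → Subset n → Set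
  Separated X Y = ∀ s t → X s ≡ true → Y t ≡ true → s ≢ t × adj G s t ≡ false

  separated-⁅⁆ : ∀ {u v} → u ≢ v → adj G u v ≡ false → Separated ⁅ u ⁆ ⁅ v ⁆
  separated-⁅⁆ {u} {v} u≢v uv s t p q with refl ← ∈-⁅⁆ {u = u} p | refl ← ∈-⁅⁆ {u = v} q = u≢v , uv

  separated-sym : ∀ {X Y} → Separated X Y → Separated Y X
  separated-sym XY s t Ys Xt with t≢s , ts ← XY t s Xt Ys = t≢s ∘ sym , trans (symmetric G s t) ts

  module _ (δ≥ : MinDegreeCond G) where

    -- Common neighbours of members of separated sets

    -- A member of one set misses the representatives of the other two, a deficit of one; `x`, `y`
    -- and `z` also miss themselves, a deficit of two. The total is the sum of the three sizes plus
    -- 3, and this 3 turns the 5 of `common-neighbour` into the 2 here.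
    separated-common-neighbour : ∀ {X Y Z x y z} (F : Subset n) →
      Separated X Y → Separated Y Z → Separated X Z → X x ≡ true → Y y ≡ true → Z z ≡ true →
      2 + # F < # X + # Y + # Z →
      ∃[ t ] (F t ≡ false × adj G x t ≡ true × adj G y t ≡ true × adj G z t ≡ true)
    separated-common-neighbour {X} {Y} {Z} {x} {y} {z} F XY YZ XZ Xx Yy Zz F< =
      common-neighbour G δ≥ x y z K F K≤ big
      where
      K : Fin n → ℕ
      K t = 𝟙 X t + 𝟙 Y t + 𝟙 Z t + (𝟙 ⁅ x ⁆ t + 𝟙 ⁅ y ⁆ t + 𝟙 ⁅ z ⁆ t)
      sum₃ : ∀ (A B C : Subset n) → sum (λ t → 𝟙 A t + 𝟙 B t + 𝟙 C t) ≡ # A + # B + # C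
      sum₃ A B C = trans (sum-+ (λ t → 𝟙 A t + 𝟙 B t) (𝟙 C)) (cong (_+ # C) (sum-+ (𝟙 A) (𝟙 B)))
      sum-K : sum K ≡ # X + # Y + # Z + 3
      sum-K = trans (sum-+ (λ t → 𝟙 X t + 𝟙 Y t + 𝟙 Z t) (λ t → 𝟙 ⁅ x ⁆ t + 𝟙 ⁅ y ⁆ t + 𝟙 ⁅ z ⁆ t))
        (cong₂ _+_ (sum₃ X Y Z)
                   (trans (sum₃ ⁅ x ⁆ ⁅ y ⁆ ⁅ z ⁆) (cong₂ _+_ (cong₂ _+_ (#-⁅⁆ x) (#-⁅⁆ y)) (#-⁅⁆ z))))
      big : 5 + # F < sum K
      big = begin
        6 + # F               ≡⟨ +-comm 3 (3 + # F) ⟩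
        3 + # F + 3           ≤⟨ +-monoˡ-≤ 3 F< ⟩
        # X + # Y + # Z + 3   ≡⟨ sum-K ⟨
        sum K                 ∎
        where open ≤-Reasoning
      absent : ∀ {A a t} → A a ≡ true → A t ≡ false → ⁅ a ⁆ t ≡ false
      absent {a = a} {t} Aa At with a ≟ t
      ... | yes refl = ⊥-elim (true≢false Aa At)
      ... | no _     = refl
      ∉ : ∀ {A B t} → Separated A B → A t ≡ true → B t ≡ false
      ∉ {B = B} {t} AB At with B t in eq
      ... | true  = ⊥-elim (proj₁ (AB t t At eq) refl)
      ... | false = refl
      nonadj : ∀ {A B s t} → Separated A B → A s ≡ true → B t ≡ true → adj G s t ≡ false
      nonadj AB As Bt = proj₂ (AB _ _ As Bt)
      nonadj′ : ∀ {A B s t} → Separated A B → A s ≡ true → B t ≡ true → adj G t s ≡ false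
      nonadj′ {s = s} {t} AB As Bt = trans (symmetric G t s) (nonadj AB As Bt)
      K≤ : ∀ t → K t ≤ 2 ∸ adj# G x y z t
      K≤ t with X t in Xt
      ... | true rewrite ∉ XY Xt | ∉ XZ Xt | absent {Y} {y} Yy (∉ XY Xt) | absent {Z} {z} Zz (∉ XZ Xt)
                       | nonadj′ XY Xt Yy | nonadj′ XZ Xt Zz with x ≟ t
      ...   | yes refl rewrite irrefl G x = ≤-refl
      ...   | no _ with adj G x t
      ...     | true  = ≤-refl
      ...     | false = s≤s z≤n
      K≤ t | false rewrite absent {X} {x} Xx Xt with Y t in Yt
      ... | true rewrite ∉ YZ Yt | absent {Z} {z} Zz (∉ YZ Yt) | nonadj XY Xx Yt | nonadj′ YZ Yt Zz with y ≟ t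
      ...   | yes refl rewrite irrefl G y = ≤-refl
      ...   | no _ with adj G y t
      ...     | true  = ≤-refl
      ...     | false = s≤s z≤n
      K≤ t | false | false rewrite absent {Y} {y} Yy Yt with Z t in Zt
      ... | false rewrite absent {Z} {z} Zz Zt = z≤n
      ... | true rewrite nonadj XZ Xx Zt | nonadj YZ Yy Zt with z ≟ t
      ...   | yes refl rewrite irrefl G z = ≤-refl
      ...   | no _ with adj G z t
      ...     | true  = ≤-refl
      ...     | false = s≤s z≤n

    -- For singletons and empty `F` the requirement is 2 < 3, met with nothing to spare.
    independent-common-neighbour : ∀ {u v w} → u ≢ v → v ≢ w → u ≢ w →
      adj G u v ≡ false → adj G v w ≡ false → adj G u w ≡ false →
      ∃[ t ] (adj G u t ≡ true × adj G v t ≡ true × adj G w t ≡ true)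
    independent-common-neighbour {u} {v} {w} u≢v v≢w u≢w uv vw uw =
      let t , _ , r = separated-common-neighbour ∅
            (separated-⁅⁆ u≢v uv) (separated-⁅⁆ v≢w vw) (separated-⁅⁆ u≢w uw) (self u) (self v) (self w) big
      in t , r
      where
      self : (x : Fin n) → ⁅ x ⁆ x ≡ true
      self x = dec-true (x ≟ x) refl
      big : 2 + # ∅ {n} < # ⁅ u ⁆ + # ⁅ v ⁆ + # ⁅ w ⁆
      big rewrite #-∅ {n} | #-⁅⁆ u | #-⁅⁆ v | #-⁅⁆ w = ≤-refl

    -- The two singletons contribute the 2 in the bound, so any `F` smaller than `X` can be avoided.
    -- Adjacency to `x` forces the common neighbour out of `Y`.
    linked : ∀ {X Y x y y′} (F : Subset n) → Separated X Y → # F < # X →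
      X x ≡ true → Y y ≡ true → Y y′ ≡ true → y ≢ y′ → adj G y y′ ≡ false →
      ∃[ w ] (F w ≡ false × adj G x w ≡ true × adj G y w ≡ true × adj G y′ w ≡ true)
    linked {X} {Y} {x} {y} {y′} F XY F<X Xx Yy Yy′ y≢y′ yy′ =
      separated-common-neighbour F (single Yy) (separated-⁅⁆ y≢y′ yy′) (single Yy′)
        Xx (dec-true (y ≟ y) refl) (dec-true (y′ ≟ y′) refl) big
      where
      single : ∀ {y} → Y y ≡ true → Separated X ⁅ y ⁆
      single {y} Yy s t Xs e with refl ← ∈-⁅⁆ {u = y} e = XY s t Xs Yy
      big : 2 + # F < # X + # ⁅ y ⁆ + # ⁅ y′ ⁆
      big rewrite #-⁅⁆ y | #-⁅⁆ y′ | +-assoc (# X) 1 1 | +-comm (# X) 2 = s≤s (s≤s F<X)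

    -- Covering the vertices by two monochromatic components

    -- Apart vertices are non-adjacent, so three of them have a common neighbour. Two of its edges
    -- to them share a colour and put their ends in one component.
    no-three-apart : ∀ {u v w} → Apart u v → Apart v w → Apart u w → ⊥
    no-three-apart {u} {v} {w} uv vw uw =
      pigeon (independent-common-neighbour (apart-≢ uv) (apart-≢ vw) (apart-≢ uw)
               (apart-nonadjacent uv) (apart-nonadjacent vw) (apart-nonadjacent uw))
      where
      meet : ∀ {x y t} → Apart x y → adj G x t ≡ true → adj G y t ≡ true → χ x t ≡ χ y t → ⊥
      meet {x} {y} {t} xy p q e = true≢false
        (component-trans (component-closed (χ y t) x x t (component-refl _ x) (p , e))
                         (component-sym (component-closed (χ y t) y y t (component-refl _ y) (q , refl))))
        (xy (χ y t))
      pigeon : ∃[ t ] (adj G u t ≡ true × adj G v t ≡ true × adj G w t ≡ true) → ⊥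
      pigeon (t , p , q , r) with χ u t in eu | χ v t in ev | χ w t in ew
      ... | true  | true  | _     = meet uv p q (trans eu (sym ev))
      ... | false | false | _     = meet uv p q (trans eu (sym ev))
      ... | true  | false | true  = meet uw p r (trans eu (sym ew))
      ... | false | true  | false = meet uw p r (trans eu (sym ew))
      ... | true  | false | false = meet vw q r (trans ev (sym ew))
      ... | false | true  | true  = meet vw q r (trans ev (sym ew))

    Covers : Bool → Bool → Fin n → Fin n → Set
    Covers c d u v = ∀ t → component c u t ≡ true ⊎ component d v t ≡ true

    covers? : ∀ c d u v → Covers c d u v ⊎ ∃[ t ] (component c u t ≡ false × component d v t ≡ false)
    covers? c d u v with any? (λ t → (component c u t ≟B false) ×-dec (component d v t ≟B false))
    ... | yes found = inj₂ found
    ... | no none   = inj₁ cover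
      where
      cover : Covers c d u v
      cover t with component c u t in p | component d v t in q
      ... | true  | _     = inj₁ refl
      ... | false | true  = inj₂ refl
      ... | false | false = ⊥-elim (none (t , p , q))

    Cover : Set
    Cover = ∃[ c ] ∃[ d ] ∃[ u ] ∃[ v ] Covers c d u v

    dichotomy : ∀ c u v → component c u v ≡ true ⊎ component c u v ≡ false
    dichotomy c u v with component c u v
    ... | true  = inj₁ refl
    ... | false = inj₂ refl

    -- König's theorem for the bipartite graph whose two classes are the red and the blue
    -- components and whose edges are the vertices of G: a matching is a set of pairwise
    -- apart vertices, so there is none of size three.
    two-components-cover : Fin n → Cover
    two-components-cover p with covers? true false p p
    ... | inj₁ cov = _ , _ , _ , _ , cov
    ... | inj₂ (q , pq-t , pq-f) with covers? true true p q | covers? false false p q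
    ...   | inj₁ cov | _        = _ , _ , _ , _ , cov
    ...   | inj₂ _   | inj₁ cov = _ , _ , _ , _ , cov
    ...   | inj₂ (r , pr , qr) | inj₂ (s , ps , qs) = cases
      where
      pq : Apart p q
      pq = apart pq-t pq-f

      -- Write red for `true`. Here `r` shares the blue component of `p`. If `s` shares the red one
      -- of `p`, then `r`, `s`, `q` is a larger matching. Otherwise the red component of `q` and the
      -- blue one of `p` cover, as any uncovered `x` would complete three apart vertices. The case
      -- of `r` in the blue component of `q` follows by exchanging `p` and `q`.
      augment : ∀ {p q} → Apart p q →
        component true p r ≡ false → component true q r ≡ false →
        component false p s ≡ false → component false q s ≡ false →
        component false p r ≡ true → component true p s ≡ true ⊎ component true q s ≡ true → Cover
      augment {p} {q} pq pr qr ps qs p-r (inj₁ p-s) = ⊥-elim (no-three-apart {r} {s} {q}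
        (apart (component-≢-sym (component-≢ p-s pr)) (component-≢ p-r ps))
        (apart (component-≢ p-s (pq true)) (component-≢-sym qs))
        (apart (component-≢-sym qr) (component-≢ p-r (pq false))))
      augment {p} {q} pq pr qr ps qs p-r (inj₂ q-s) with covers? true false q p
      ... | inj₁ cov = _ , _ , _ , _ , cov
      ... | inj₂ (x , qx , px) with dichotomy true p x | dichotomy false s x | dichotomy true r x | dichotomy false q x
      ...   | inj₁ p-x | inj₁ s-x | _ | _ = ⊥-elim (no-three-apart {x} {q} {r}
        (apart (component-≢ p-x (pq true)) (component-≢ s-x (component-≢-sym qs)))
        (apart qr (component-≢-sym (component-≢ p-r (pq false))))
        (apart (component-≢ p-x pr) (component-≢-sym (component-≢ p-r px))))
      ...   | inj₁ p-x | inj₂ sx | _ | _ = ⊥-elim (no-three-apart {x} {s} {r}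
        (apart (component-≢-sym (component-≢ q-s qx)) (component-≢-sym sx))
        (apart (component-≢ q-s qr) (component-≢-sym (component-≢ p-r ps)))
        (apart (component-≢ p-x pr) (component-≢-sym (component-≢ p-r px))))
      ...   | inj₂ p≁x | _ | _ | inj₂ q≁x = ⊥-elim (no-three-apart pq (apart qx q≁x) (apart p≁x px))
      ...   | inj₂ p≁x | _ | inj₁ r-x | inj₁ q-x = ⊥-elim (no-three-apart {x} {s} {p}
        (apart (component-≢-sym (component-≢ q-s qx)) (component-≢ q-x qs))
        (apart (component-≢ q-s (component-≢-sym (pq true))) (component-≢-sym ps))
        (apart (component-≢-sym p≁x) (component-≢-sym px)))
      ...   | inj₂ p≁x | _ | inj₂ rx | inj₁ q-x = ⊥-elim (no-three-apart {x} {s} {r}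
        (apart (component-≢-sym (component-≢ q-s qx)) (component-≢ q-x qs))
        (apart (component-≢ q-s qr) (component-≢-sym (component-≢ p-r ps)))
        (apart (component-≢-sym rx) (component-≢-sym (component-≢ p-r px))))

      s-side : component true p s ≡ true ⊎ component true q s ≡ true
      s-side with dichotomy true p s | dichotomy true q s
      ... | inj₁ p-s | _        = inj₁ p-s
      ... | inj₂ _   | inj₁ q-s = inj₂ q-s
      ... | inj₂ p≁s | inj₂ q≁s = ⊥-elim (no-three-apart pq (apart q≁s qs) (apart p≁s ps))

      cases : Cover
      cases with dichotomy false p r | dichotomy false q r
      ... | inj₁ p-r | _        = augment pq pr qr ps qs p-r s-side
      ... | inj₂ _   | inj₁ q-r = augment (λ c → component-≢-sym (pq c)) qr pr qs ps q-r (swap s-side)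
      ... | inj₂ p≁r | inj₂ q≁r = ⊥-elim (no-three-apart pq (apart qr q≁r) (apart pr p≁r))

    -- A cover by two components of different colours

    module _ (c : Bool) (X Y : Subset n) (x₀ y₀ : Fin n) (Xx₀ : X x₀ ≡ true) (Yy₀ : Y y₀ ≡ true)
             (disjoint : ∀ t → X t ≡ true → Y t ≡ true → ⊥)
             (outX : ∀ x t → X x ≡ true → X t ≡ false → adj G x t ≡ true → χ x t ≡ c)
             (outY : ∀ y t → Y y ≡ true → Y t ≡ false → adj G y t ≡ true → χ y t ≡ not c)
             (∁X-connected : Connected (not c) (∁ X)) (∁Y-connected : Connected c (∁ Y)) where

      ∉Y : ∀ {t} → X t ≡ true → Y t ≡ false
      ∉Y {t} Xt with Y t in eq
      ... | true  = ⊥-elim (disjoint t Xt eq)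
      ... | false = refl

      ∉X : ∀ {t} → Y t ≡ true → X t ≡ false
      ∉X {t} Yt with X t in eq
      ... | true  = ⊥-elim (disjoint t eq Yt)
      ... | false = refl

      -- An edge between the sets would leave both, and so have colour `c` and colour `not c`.
      X|Y : Separated X Y
      X|Y s t Xs Yt = (λ { refl → disjoint s Xs Yt }) , nonadjacent
        where
        nonadjacent : adj G s t ≡ false
        nonadjacent with adj G s t in st
        ... | false = refl
        ... | true  = ⊥-elim (not-¬ (outX s t Xs (∉X Yt) st)
          (trans (χ-sym s t) (outY t s Yt (∉Y Xs) (trans (symmetric G t s) st))))

      adjX⇒∉Y : ∀ {x w} → X x ≡ true → adj G x w ≡ true → Y w ≡ false
      adjX⇒∉Y {x} {w} Xx xw with Y w in eq
      ... | true  = ⊥-elim (true≢false xw (proj₂ (X|Y x w Xx eq)))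
      ... | false = refl

      adjY⇒∉X : ∀ {y w} → Y y ≡ true → adj G y w ≡ true → X w ≡ false
      adjY⇒∉X {y} {w} Yy yw with X w in eq
      ... | true  = ⊥-elim (true≢false yw (proj₂ (separated-sym X|Y y w Yy eq)))
      ... | false = refl

      record Growth (P Q : Subset n) : Set where
        field
          connP : Connected c P
          connQ : Connected (not c) Q
          X⊆P   : ∀ t → X t ≡ true → P t ≡ true
          Y⊆Q   : ∀ t → Y t ≡ true → Q t ≡ true
          P∩Q   : ∀ t → P t ≡ true → Q t ≡ true → ⊥
      open Growth

      extendP : ∀ {P Q s t} → Growth P Q → P s ≡ true → Q t ≡ false → Edge c s t → Growth (insert t P) Q
      extendP {P} {Q} {s} {t} g Ps Qt e = record
        { connP = connected-insert (connP g) Ps e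
        ; connQ = connQ g
        ; X⊆P   = λ u Xu → ∈-insertˡ {w = t} {S = P} (X⊆P g u Xu)
        ; Y⊆Q   = Y⊆Q g
        ; P∩Q   = λ u Pu Qu → [ (λ Pu → P∩Q g u Pu Qu) , (λ { refl → true≢false Qu Qt }) ]′
                                (∈-insert⁻ {w = t} {S = P} Pu)
        }

      extendQ : ∀ {P Q s t} → Growth P Q → Q s ≡ true → P t ≡ false → Edge (not c) s t → Growth P (insert t Q)
      extendQ {P} {Q} {s} {t} g Qs Pt e = record
        { connP = connP g
        ; connQ = connected-insert (connQ g) Qs e
        ; X⊆P   = X⊆P g
        ; Y⊆Q   = λ u Yu → ∈-insertˡ {w = t} {S = Q} (Y⊆Q g u Yu)
        ; P∩Q   = λ u Pu Qu → [ P∩Q g u Pu , (λ { refl → true≢false Pu Pt }) ]′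
                                (∈-insert⁻ {w = t} {S = Q} Qu)
        }

      ∉P⇒∉X : ∀ {P Q t} → Growth P Q → P t ≡ false → X t ≡ false
      ∉P⇒∉X {t = t} g Pt with X t in eq
      ... | true  = ⊥-elim (true≢false (X⊆P g t eq) Pt)
      ... | false = refl

      ∉Q⇒∉Y : ∀ {P Q t} → Growth P Q → Q t ≡ false → Y t ≡ false
      ∉Q⇒∉Y {t = t} g Qt with Y t in eq
      ... | true  = ⊥-elim (true≢false (Y⊆Q g t eq) Qt)
      ... | false = refl

      Isolated : Fin n → Set
      Isolated t = X t ≡ false × Y t ≡ false × ¬ (∃[ s ] ((X ∪ Y) s ≡ true × adj G s t ≡ true))

      isolated? : ∀ t → Dec (Isolated t)
      isolated? t = (X t ≟B false) ×-dec (Y t ≟B false) ×-dec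
                    ¬? (any? (λ s → ((X ∪ Y) s ≟B true) ×-dec (adj G s t ≟B true)))

      I : Subset n
      I t = does (isolated? t)

      ∈I : ∀ {t} → I t ≡ true → Isolated t
      ∈I {t} = does-true (isolated? t)

      X∪Y|I : Separated (X ∪ Y) I
      X∪Y|I s t s∈ It with Xt , Yt , none ← ∈I {t} It =
        (λ { refl → [ (λ Xs → true≢false Xs Xt) , (λ Ys → true≢false Ys Yt) ]′ (∨-true s∈) }) , nonadjacent
        where
        nonadjacent : adj G s t ≡ false
        nonadjacent with adj G s t in st
        ... | false = refl
        ... | true  = ⊥-elim (none (s , s∈ , st))

      X⊆X∪Y : ∀ {t} → X t ≡ true → (X ∪ Y) t ≡ true
      X⊆X∪Y = ∪-introˡ {S = X} {Y}

      Y⊆X∪Y : ∀ {t} → Y t ≡ true → (X ∪ Y) t ≡ true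
      Y⊆X∪Y = ∪-introʳ {S = X} {Y}

      -- A vertex left over is not in `I`, so it has a neighbour in `X` or `Y`. Being outside `P`
      -- and `Q`, it is outside `X` and `Y` too, and the edge has the colour of the side to be
      -- joined.
      attach-rest : ∀ {P Q} → Growth P Q → (∀ t → I t ≡ true → (P ∪ Q) t ≡ true) → TwoMonoPartition G χ
      attach-rest g I⊆ = descend {A = State} (λ (P , Q , _) → # ∁ (P ∪ Q)) grow (_ , _ , g , I⊆)
        where
        State : Set
        State = ∃[ P ] ∃[ Q ] (Growth P Q × (∀ t → I t ≡ true → (P ∪ Q) t ≡ true))
        fewer : ∀ {A B : Subset n} {t} → A t ≡ false → B t ≡ true → (∀ u → A u ≡ true → B u ≡ true) → # ∁ B < # ∁ A
        fewer {A} {B} {t} At Bt A⊆B = #-remove {w = t} (cong not At) shrink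
          where
          shrink : ∀ u → ∁ B u ≡ true → ∁ A u ≡ true × t ≢ u
          shrink u e with A u in Au
          ... | true  = ⊥-elim (true≢false (A⊆B u Au) (not-true e))
          ... | false = refl , λ { refl → true≢false Bt (not-true e) }
        grow : ((P , Q , _) : State) → TwoMonoPartition G χ ⊎ ∃ λ ((P′ , Q′ , _) : State) → # ∁ (P′ ∪ Q′) < # ∁ (P ∪ Q)
        grow (P , Q , g , I⊆) with any? (λ t → (P ∪ Q) t ≟B false)
        ... | no none = inj₁ (partition P Q (connP g) (connQ g) (P∩Q g) cover)
          where
          cover : ∀ t → P t ≡ true ⊎ Q t ≡ true
          cover t with (P ∪ Q) t in eq
          ... | true  = ∨-true eq
          ... | false = ⊥-elim (none (t , eq))
        ... | yes (t , t∉) with any? (λ s → ((X ∪ Y) s ≟B true) ×-dec (adj G s t ≟B true))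
        ...   | no none = ⊥-elim (true≢false (I⊆ t (dec-true (isolated? t) (Xt , Yt , none))) t∉)
          where
          Xt = ∉P⇒∉X g (proj₁ (∨-false t∉))
          Yt = ∉Q⇒∉Y g (proj₂ (∨-false t∉))
        ...   | yes (s , s∈ , st) with Pt , Qt ← ∨-false {P t} t∉ | ∨-true {X s} s∈
        ...     | inj₁ Xs = inj₂ ((insert t P , Q , extendP g (X⊆P g s Xs) Qt (st , outX s t Xs (∉P⇒∉X g Pt) st) ,
                                    λ u Iu → wider u (I⊆ u Iu)) , fewer {P ∪ Q} {t = t} t∉ covered wider)
          where
          wider : ∀ u → (P ∪ Q) u ≡ true → (insert t P ∪ Q) u ≡ true
          wider u = ∪-mono {S = P} {Q} {insert t P} {Q} (λ u → ∈-insertˡ {w = t} {S = P}) (λ u → id) u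
          covered : (insert t P ∪ Q) t ≡ true
          covered rewrite ∈-insert t P = refl
        ...     | inj₂ Ys = inj₂ ((P , insert t Q , extendQ g (Y⊆Q g s Ys) Pt (st , outY s t Ys (∉Q⇒∉Y g Qt) st) ,
                                    λ u Iu → wider u (I⊆ u Iu)) , fewer {P ∪ Q} {t = t} t∉ covered wider)
          where
          wider : ∀ u → (P ∪ Q) u ≡ true → (P ∪ insert t Q) u ≡ true
          wider u = ∪-mono {S = P} {Q} {P} {insert t Q} (λ u → id) (λ u → ∈-insertˡ {w = t} {S = Q}) u
          covered : (P ∪ insert t Q) t ≡ true
          covered = ∪-introʳ {S = P} {insert t Q} (∈-insert t Q)

      -- Absorbing the vertices without neighbours in the two sets

      -- A round uses up at most one connector and absorbs at least one vertex of `I`, so the number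
      -- of connectors plus the number of vertices to absorb never grows.
      absorb-isolated : ∀ {P Q} → Growth P Q → # (P ∖ X) < # X → # (Q ∖ Y) < # Y →
                        ∃[ P′ ] ∃[ Q′ ] (Growth P′ Q′ × (∀ t → I t ≡ true → (P′ ∪ Q′) t ≡ true))
      absorb-isolated {P₀} {Q₀} g₀ P< Q< = descend {A = State} (λ (P , Q , _) → # U (P ∪ Q)) grow (P₀ , Q₀ , g₀ , start)
        where
        -- U: isolated vertices still to be absorbed; E: vertices used up as connectors.
        U E : Subset n → Subset n
        U A = I ∖ A
        E A = A ∖ (X ∪ Y ∪ I)
        -- The 2 collects the two strict inequalities on the hulls; it is the 2 that
        -- `separated-common-neighbour` asks for.
        Bounded : Subset n → Set
        Bounded A = 2 + (# E A + # U A) ≤ # X + # Y + # I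
        State : Set
        State = ∃[ P ] ∃[ Q ] (Growth P Q × Bounded (P ∪ Q))

        start : Bounded (P₀ ∪ Q₀)
        start = begin
          2 + (# E (P₀ ∪ Q₀) + # U (P₀ ∪ Q₀))     ≤⟨ +-monoʳ-≤ 2 (+-mono-≤ (#-∪ {T = P₀ ∖ X} {Q₀ ∖ Y} used)
                                                       (#-mono {T = I} (λ t e → proj₁ (∈-∖⁻ {S = I} {P₀ ∪ Q₀} e)))) ⟩
          2 + (# (P₀ ∖ X) + # (Q₀ ∖ Y) + # I)     ≡⟨ spread (# (P₀ ∖ X)) (# (Q₀ ∖ Y)) (# I) ⟩
          suc (# (P₀ ∖ X)) + suc (# (Q₀ ∖ Y)) + # I ≤⟨ +-monoˡ-≤ (# I) (+-mono-≤ P< Q<) ⟩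
          # X + # Y + # I                         ∎
          where
          open ≤-Reasoning
          spread : ∀ a b i → 2 + (a + b + i) ≡ suc a + suc b + i
          spread = solve-∀
          used : ∀ t → E (P₀ ∪ Q₀) t ≡ true → (P₀ ∖ X) t ≡ true ⊎ (Q₀ ∖ Y) t ≡ true
          used t e with p , q ← ∈-∖⁻ {S = P₀ ∪ Q₀} {X ∪ Y ∪ I} e
            with Xt , Yt ← ∨-false {X t} (proj₁ (∨-false {(X ∪ Y) t} q)) | ∨-true {P₀ t} p
          ... | inj₁ Pt = inj₁ (∈-∖ {S = P₀} {X} Pt Xt)
          ... | inj₂ Qt = inj₂ (∈-∖ {S = Q₀} {Y} Qt Yt)

        module _ {A B : Subset n} {z w} (Uz : U A z ≡ true) (A⊆B : ∀ t → A t ≡ true → B t ≡ true) (Bz : B z ≡ true)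
                 (B⊆ : ∀ t → B t ≡ true → A t ≡ true ⊎ w ≡ t ⊎ z ≡ t) where

          fewer : # U B < # U A
          fewer = #-remove {w = z} Uz shrink
            where
            shrink : ∀ t → U B t ≡ true → U A t ≡ true × z ≢ t
            shrink t e with It , Bt ← ∈-∖⁻ {S = I} {B} e with A t in At
            ... | true  = ⊥-elim (true≢false (A⊆B t At) Bt)
            ... | false rewrite It = refl , λ { refl → true≢false Bz Bt }

          one-more : # E B ≤ suc (# E A)
          one-more = #-insert {w = w} new
            where
            new : ∀ t → E B t ≡ true → E A t ≡ true ⊎ w ≡ t
            new t e with Bt , t∉ ← ∈-∖⁻ {S = B} {X ∪ Y ∪ I} e with B⊆ t Bt
            ... | inj₁ At          = inj₁ (∈-∖ {S = A} {X ∪ Y ∪ I} At t∉)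
            ... | inj₂ (inj₁ w≡t)  = inj₂ w≡t
            ... | inj₂ (inj₂ refl) = ⊥-elim (true≢false (proj₁ (∈-∖⁻ {S = I} {A} Uz)) (proj₂ (∨-false {(X ∪ Y) t} t∉)))

          bounded : Bounded A → Bounded B
          bounded b = ≤-trans (+-monoʳ-≤ 2 (begin
            # E B + # U B         ≤⟨ +-monoˡ-≤ (# U B) one-more ⟩
            suc (# E A) + # U B   ≡⟨ +-suc (# E A) (# U B) ⟨
            # E A + suc (# U B)   ≤⟨ +-monoʳ-≤ (# E A) fewer ⟩
            # E A + # U A         ∎)) b
            where open ≤-Reasoning

        absorb : ∀ {P Q z} → Growth P Q → Bounded (P ∪ Q) → U (P ∪ Q) z ≡ true →
                 ∃ λ ((P′ , Q′ , _) : State) → # U (P′ ∪ Q′) < # U (P ∪ Q)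
        absorb {P} {Q} {z} g b Uz = place neighbour (χ z (proj₁ neighbour) ≟B c)
          where
          Iz : I z ≡ true
          Iz = proj₁ (∈-∖⁻ {S = I} {P ∪ Q} Uz)
          z∉ : (P ∪ Q) z ≡ false
          z∉ = proj₂ (∈-∖⁻ {S = I} {P ∪ Q} Uz)
          -- Strictness comes from `z`, which is still counted in `U`.
          room : 2 + # E (P ∪ Q) < # X + # Y + # I
          room = ≤-trans (+-monoʳ-≤ 2 (begin
            suc (# E (P ∪ Q))           ≡⟨ +-comm 1 (# E (P ∪ Q)) ⟩
            # E (P ∪ Q) + 1             ≤⟨ +-monoʳ-≤ (# E (P ∪ Q)) (≤-trans (s≤s z≤n) (#-remove {S = ∅} {w = z} Uz (λ _ ()))) ⟩
            # E (P ∪ Q) + # U (P ∪ Q)   ∎)) b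
            where open ≤-Reasoning
          Neighbour : Set
          Neighbour = ∃[ w ] (E (P ∪ Q) w ≡ false × adj G x₀ w ≡ true × adj G y₀ w ≡ true × adj G z w ≡ true)
          neighbour : Neighbour
          neighbour = separated-common-neighbour (E (P ∪ Q))
            X|Y (λ s t Ys It → X∪Y|I s t (Y⊆X∪Y Ys) It) (λ s t Xs It → X∪Y|I s t (X⊆X∪Y Xs) It) Xx₀ Yy₀ Iz room
          module _ (nb : Neighbour) where
            w   = proj₁ nb
            x₀w = proj₁ (proj₂ (proj₂ nb))
            y₀w = proj₁ (proj₂ (proj₂ (proj₂ nb)))
            zw  = proj₂ (proj₂ (proj₂ (proj₂ nb)))
            Xw : X w ≡ false
            Xw = adjY⇒∉X Yy₀ y₀w
            Yw : Y w ≡ false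
            Yw = adjX⇒∉Y Xx₀ x₀w
            Iw : I w ≡ false
            Iw with I w in eq
            ... | true  = ⊥-elim (true≢false x₀w (proj₂ (X∪Y|I x₀ w (X⊆X∪Y Xx₀) eq)))
            ... | false = refl
            -- `E` holds all of `P ∪ Q` except `X`, `Y` and `I`, and `w` avoids these three as well
            -- as `E`.
            w∉ : (P ∪ Q) w ≡ false
            w∉ = ∉-∖ {S = P ∪ Q} {X ∪ Y ∪ I} (proj₁ (proj₂ nb))
                   (∉-∪ {S = X ∪ Y} {I} (∉-∪ {S = X} {Y} Xw Yw) Iw)
            P′ = insert z (insert w P)
            Q′ = insert z (insert w Q)
            -- The edge from `x₀` to `w` has colour `c` and the one from `y₀` has colour `not c`, so
            -- `w` can join either side; the colour of the edge `zw` selects the side on which `z`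
            -- can follow.
            place : Dec (χ z w ≡ c) → ∃ λ ((P′ , Q′ , _) : State) → # U (P′ ∪ Q′) < # U (P ∪ Q)
            place (yes zw-c) = ((P′ , Q , g′ , bounded Uz wider covered new b) , fewer {w = w} Uz wider covered new)
              where
              g′ : Growth P′ Q
              g′ = extendP (extendP g (X⊆P g x₀ Xx₀) (proj₂ (∨-false {P w} w∉)) (x₀w , outX x₀ w Xx₀ Xw x₀w))
                     (∈-insert w P) (proj₂ (∨-false {P z} z∉)) (edge-sym (zw , zw-c))
              wider : ∀ u → (P ∪ Q) u ≡ true → (P′ ∪ Q) u ≡ true
              wider = ∪-mono {S = P} {Q} {P′} {Q} (λ u e → ∈-insertˡ {w = z} {S = insert w P} (∈-insertˡ {w = w} {S = P} e)) (λ u → id)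
              covered : (P′ ∪ Q) z ≡ true
              covered rewrite ∈-insert z (insert w P) = refl
              new : ∀ t → (P′ ∪ Q) t ≡ true → (P ∪ Q) t ≡ true ⊎ w ≡ t ⊎ z ≡ t
              new t e with ∨-true {P′ t} e
              ... | inj₂ Qt = inj₁ (∪-introʳ {S = P} {Q} Qt)
              ... | inj₁ P′t with ∈-insert⁻ {w = z} {S = insert w P} P′t
              ...   | inj₂ z≡t = inj₂ (inj₂ z≡t)
              ...   | inj₁ Pt with ∈-insert⁻ {w = w} {S = P} Pt
              ...     | inj₁ Pt  = inj₁ (∪-introˡ {S = P} {Q} Pt)
              ...     | inj₂ w≡t = inj₂ (inj₁ w≡t)
            place (no zw-c) = ((P , Q′ , g′ , bounded Uz wider covered new b) , fewer {w = w} Uz wider covered new)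
              where
              g′ : Growth P Q′
              g′ = extendQ (extendQ g (Y⊆Q g y₀ Yy₀) (proj₁ (∨-false {P w} w∉)) (y₀w , outY y₀ w Yy₀ Yw y₀w))
                     (∈-insert w Q) (proj₁ (∨-false {P z} z∉)) (edge-sym (zw , ¬-not zw-c))
              wider : ∀ u → (P ∪ Q) u ≡ true → (P ∪ Q′) u ≡ true
              wider = ∪-mono {S = P} {Q} {P} {Q′} (λ u → id) (λ u e → ∈-insertˡ {w = z} {S = insert w Q} (∈-insertˡ {w = w} {S = Q} e))
              covered : (P ∪ Q′) z ≡ true
              covered = ∪-introʳ {S = P} {Q′} (∈-insert z (insert w Q))
              new : ∀ t → (P ∪ Q′) t ≡ true → (P ∪ Q) t ≡ true ⊎ w ≡ t ⊎ z ≡ t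
              new t e with ∨-true {P t} e
              ... | inj₁ Pt = inj₁ (∪-introˡ {S = P} {Q} Pt)
              ... | inj₂ Q′t with ∈-insert⁻ {w = z} {S = insert w Q} Q′t
              ...   | inj₂ z≡t = inj₂ (inj₂ z≡t)
              ...   | inj₁ Qt with ∈-insert⁻ {w = w} {S = Q} Qt
              ...     | inj₁ Qt  = inj₁ (∪-introʳ {S = P} {Q} Qt)
              ...     | inj₂ w≡t = inj₂ (inj₁ w≡t)

        grow : ((P , Q , _) : State) →
               (∃[ P′ ] ∃[ Q′ ] (Growth P′ Q′ × (∀ t → I t ≡ true → (P′ ∪ Q′) t ≡ true))) ⊎
               ∃ λ ((P′ , Q′ , _) : State) → # U (P′ ∪ Q′) < # U (P ∪ Q)
        grow (P , Q , g , b) with any? (λ t → U (P ∪ Q) t ≟B true)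
        ... | no none = inj₁ (P , Q , g , I⊆)
          where
          I⊆ : ∀ t → I t ≡ true → (P ∪ Q) t ≡ true
          I⊆ t It with (P ∪ Q) t in eq
          ... | true  = refl
          ... | false = ⊥-elim (none (t , ∈-∖ {S = I} {P ∪ Q} It eq))
        ... | yes (z , Uz) = inj₂ (absorb g b Uz)

      -- `P` gains only vertices outside `Y`, and `Q` only vertices outside `P`, so the hulls are
      -- disjoint.
      extend-hulls : ∀ {P Q} → Hull c X (λ w → Y w ≡ false) P → Hull (not c) Y (λ w → P w ≡ false) Q → TwoMonoPartition G χ
      extend-hulls {P} {Q} (P-connected , X⊆ , P⊆ , P<) (Q-connected , Y⊆ , Q⊆ , Q<) =
        let P′ , Q′ , g , I⊆ = absorb-isolated
              (record { connP = P-connected ; connQ = Q-connected ; X⊆P = X⊆ ; Y⊆Q = Y⊆ ; P∩Q = P|Q }) P< Q<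
        in attach-rest g I⊆
        where
        P|Q : ∀ t → P t ≡ true → Q t ≡ true → ⊥
        P|Q t Pt Qt with Q⊆ t Qt
        ... | inj₂ Pt′ = true≢false Pt Pt′
        ... | inj₁ Yt with P⊆ t Pt
        ...   | inj₁ Xt  = disjoint t Xt Yt
        ...   | inj₂ Yt′ = true≢false Yt Yt′

      -- If `X` is connected in colour `not c`, or `Y` in colour `c`, that set and its complement
      -- are the partition. Otherwise both have hulls, the second built around the first.
      red-blue-partition : TwoMonoPartition G χ
      red-blue-partition =
        [ (λ X-connected → X , not c , not c , X-connected , ∁X-connected)
        , (λ (P , hullX) →
            [ (λ Y-connected → Y , not (not c) , c , Y-connected , ∁Y-connected)
            , (λ (Q , hullY) → extend-hulls hullX hullY)
            ]′ (connect (λ w → P w ≡ false) Yy₀ outY (linkY hullX)))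
        ]′ (connect (λ w → Y w ≡ false) Xx₀ outX linkX)
        where
        linkX : ∀ a b → X a ≡ true → X b ≡ true → a ≢ b → adj G a b ≡ false →
                ∃[ w ] (Y w ≡ false × X w ≡ false × adj G a w ≡ true × adj G b w ≡ true)
        linkX a b Xa Xb a≢b ab
          with w , _ , y₀w , aw , bw ← linked ∅ (separated-sym X|Y) (#-remove {S = ∅} {w = y₀} Yy₀ (λ _ ())) Yy₀ Xa Xb a≢b ab
          = w , adjX⇒∉Y Xa aw , adjY⇒∉X Yy₀ y₀w , aw , bw
        -- The additional vertices of the first hull number fewer than `X`, so `linked` can avoid
        -- them. A neighbour of `a` is also outside `X`, hence outside all of `P`.
        linkY : ∀ {P} → Hull c X (λ w → Y w ≡ false) P → ∀ a b → Y a ≡ true → Y b ≡ true → a ≢ b → adj G a b ≡ false →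
                ∃[ w ] (P w ≡ false × Y w ≡ false × adj G a w ≡ true × adj G b w ≡ true)
        linkY {P} (_ , _ , _ , P<) a b Ya Yb a≢b ab
          with w , Fw , x₀w , aw , bw ← linked (P ∖ X) X|Y P< Xx₀ Ya Yb a≢b ab
          = w , ∉-∖ {S = P} {X} Fw (adjY⇒∉X Ya aw) , adjX⇒∉Y Xx₀ x₀w , aw , bw

    -- From covers to partitions

    -- The distinct `p` and `q` serve the case of a component containing every vertex, which must be
    -- split into two non-empty classes.
    opposite-components-partition : ∀ {c u v p q} → p ≢ q → Covers c (not c) u v → TwoMonoPartition G χ
    opposite-components-partition {c} {u} {v} p≢q cov
      with any? (λ t → component (not c) v t ≟B false) | any? (λ t → component c u t ≟B false)
    ... | no none | _ = whole-connected p≢q (component-connected (not c) v) (λ t → ¬-not (λ e → none (t , e)))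
    ... | yes _ | no none = whole-connected p≢q (component-connected c u) (λ t → ¬-not (λ e → none (t , e)))
    ... | yes (x₀ , x₀∉B) | yes (y₀ , y₀∉R) =
      red-blue-partition c (∁ B) (∁ R) x₀ y₀ (cong not x₀∉B) (cong not y₀∉R) disjoint outX outY
        (connected-cong (λ t e → trans (not-involutive (B t)) e) (λ t e → trans (sym (not-involutive (B t))) e)
          (component-connected (not c) v))
        (connected-cong (λ t e → trans (not-involutive (R t)) e) (λ t e → trans (sym (not-involutive (R t))) e)
          (component-connected c u))
      where
      R = component c u
      B = component (not c) v
      disjoint : ∀ t → ∁ B t ≡ true → ∁ R t ≡ true → ⊥
      disjoint t Bt Rt = [ (λ e → true≢false e (not-true Rt)) , (λ e → true≢false e (not-true Bt)) ]′ (cov t)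
      outwards : ∀ {d w} x t → ∁ (component d w) x ≡ true → ∁ (component d w) t ≡ false → adj G x t ≡ true → χ x t ≡ not d
      outwards {d} {w} x t x∉ t∈ xt = ¬-not (λ e →
        true≢false (component-closed d w t x (trans (sym (not-involutive (component d w t))) (cong not t∈)) (edge-sym (xt , e)))
                   (not-true x∉))
      outX : ∀ x t → ∁ B x ≡ true → ∁ B t ≡ false → adj G x t ≡ true → χ x t ≡ c
      outX x t x∉ t∈ xt = trans (outwards x t x∉ t∈ xt) (not-involutive c)
      outY : ∀ y t → ∁ R y ≡ true → ∁ R t ≡ false → adj G y t ≡ true → χ y t ≡ not c
      outY = outwards

    same-colour-components-partition : ∀ {c u v p q} → p ≢ q → Covers c c u v → TwoMonoPartition G χ
    same-colour-components-partition {c} {u} {v} p≢q cov with component c u v in uv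
    ... | true  = whole-connected p≢q (component-connected c u) (λ t → [ id , component-trans uv ]′ (cov t))
    ... | false = partition (component c u) (component c v) (component-connected c u) (component-connected c v)
                    (λ t ut vt → true≢false (component-trans ut (component-sym vt)) uv) cov

    two-mono-partition : ∀ {p q : Fin n} → p ≢ q → TwoMonoPartition G χ
    two-mono-partition {p} p≢q with c , d , u , v , cov ← two-components-cover p with d ≟B c
    ... | yes refl = same-colour-components-partition p≢q cov
    ... | no d≢c with refl ← ¬-not d≢c = opposite-components-partition p≢q cov

theorem1p2 : ∃[ n₀ ] (∀ (n : ℕ) → n₀ ≤ n → (G : Graph n) → MinDegreeCond G →
    (χ : Colouring n) → SymColouring χ → TwoMonoPartition G χ)
-- Two non-empty classes require two distinct vertices, and from 2 vertices on the argument applies.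
theorem1p2 = 2 , λ { (suc (suc n)) (s≤s (s≤s _)) G δ≥ χ χ-sym → two-mono-partition G χ χ-sym δ≥ {zero} {suc zero} (λ ()) }
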